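{- Let $M\ge 2$ be an integer and fix an integer $r\ge3$. Then there exists a non-unimodal pure $O$-sequence of codimension $r$ (i.e. with $h_1=r$) having exactly $M$ maxima.
   Context: A monomial order ideal is a finite nonempty set of monomials closed under taking divisors; it is pure if all its maximal monomials under divisibility have the same degree $e$. A pure $O$-sequence is the vector $(h_0,\dots,h_e)$ counting the monomials of each degree in a pure monomial order ideal; its codimension is $h_1$. A sequence is unimodal if $h_0\le\dots\le h_j\ge h_{j+1}\ge\dots\ge h_e$ for some $j$. A maximum (peak) of $(h_0,\dots,h_e)$ is a maximal run of equal consecutive entries $h_a=\dots=h_b$ such that either $a=0$ or $h_{a-1}<h_a$, and either $b=e$ or $h_b>h_{b+1}$. -}

module Defs where

open import Data.Nat using (ℕ; zero; suc; _≤_; _<_; _≟_)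
open import Data.Vec using (Vec; []; _∷_)
open import Data.Vec.Relation.Binary.Pointwise.Inductive using (Pointwise)
open import Data.List using (List; []; _∷_; length; filter)
open import Data.List.Membership.Propositional using (_∈_)
open import Data.List.Relation.Unary.Unique.Propositional using (Unique)
open import Data.Product using (Σ; _×_; _,_)
open import Data.Sum using (_⊎_)
open import Relation.Binary.PropositionalEquality using (_≡_)
open import Function.Bundles using (_⇔_)

-- A monomial in n variables x₁,…,xₙ, given by its exponent vector.
Monomial : ℕ → Set
Monomial n = Vec ℕ n

deg : ∀ {n} → Monomial n → ℕ
deg []       = 0
deg (a ∷ m) = a Data.Nat.+ deg m

_∣ₘ_ : ∀ {n} → Monomial n → Monomial n → Set
d ∣ₘ m = Pointwise _≤_ d m

record OrderIdeal (n : ℕ) : Set where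
  field
    elems    : List (Monomial n)
    unique   : Unique elems
    nonempty : Σ (Monomial n) (λ m → m ∈ elems)
    closed   : ∀ m → m ∈ elems → ∀ d → d ∣ₘ m → d ∈ elems
open OrderIdeal public

IsMaximal : ∀ {n} → OrderIdeal n → Monomial n → Set
IsMaximal X m = m ∈ elems X × (∀ m' → m' ∈ elems X → m ∣ₘ m' → m' ≡ m)

IsPure : ∀ {n} → OrderIdeal n → ℕ → Set
IsPure X e = ∀ m → IsMaximal X m → deg m ≡ e

countDeg : ∀ {n} → OrderIdeal n → ℕ → ℕ
countDeg X i = length (filter (λ m → deg m ≟ i) (elems X))

-- i-th entry of a sequence (h₀,…,hₑ) (0 outside the range; only used for i ≤ e)
_!_ : ∀ {k} → Vec ℕ k → ℕ → ℕ
[]      ! _     = 0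
(x ∷ _) ! zero  = x
(_ ∷ v) ! suc i = v ! i

IsPureOSeq : ∀ {e} → Vec ℕ (suc e) → Set
IsPureOSeq {e} h =
  Σ ℕ λ n → Σ (OrderIdeal n) λ X →
    IsPure X e × (∀ i → i ≤ e → h ! i ≡ countDeg X i)

Unimodal : ∀ {e} → Vec ℕ (suc e) → Set
Unimodal {e} h =
  Σ ℕ λ j → j ≤ e ×
    (∀ i → suc i ≤ j → h ! i ≤ h ! suc i) ×
    (∀ i → j ≤ i → suc i ≤ e → h ! suc i ≤ h ! i)

-- (a , b) is a maximum (peak): a maximal run hₐ = … = h_b with
-- (a = 0 or hₐ₋₁ < hₐ) and (b = e or h_b > h_{b+1})
IsMaximum : ∀ {e} → Vec ℕ (suc e) → ℕ × ℕ → Set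
IsMaximum {e} h (a , b) =
  a ≤ b × b ≤ e ×
  (∀ i → a ≤ i → i ≤ b → h ! i ≡ h ! a) ×
  (a ≡ 0 ⊎ Σ ℕ (λ a' → a ≡ suc a' × h ! a' < h ! a)) ×
  (b ≡ e ⊎ (b < e × h ! suc b < h ! b))

HasExactlyMaxima : ∀ {e} → ℕ → Vec ℕ (suc e) → Set
HasExactlyMaxima M h =
  Σ (List (ℕ × ℕ)) λ L → Unique L × length L ≡ M ×
    (∀ p → (p ∈ L) ⇔ IsMaximum h p)

{-# OPTIONS --safe #-}
module Submission where

-- Put N = 3 (M - 1), A = 3 N + 3 and e = A + 2 N, and let X consist of the monomials x^i y^j z^k
-- of degree at most e such that i + j < A, or i < width (e - (i + j)) where
-- width v = 3 ⌊v / 3⌋ + 3, or x^i y^j z^k divides x^A y^N z^N.  The first two kinds form a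
-- cylinder in the z-direction cut off at degree e; X is pure of socle degree e.  Counting the
-- columns in the z-direction that start or end in each degree, the Hilbert function of X
-- increases up to degree A + N, and the step from degree e - 1 - v to e - v is
-- width v - (v + 2) for v < N.  Read upwards in degree, the signs of these steps repeat the
-- pattern (-, 0, +), so the maxima are exactly the degrees e - 3 k with k < M.
-- Adjoining the e-th power of a new variable adds 1 to every entry in degrees 1, ..., e, which
-- does not move the maxima and raises the codimension by 1.

open import Defs
open import Data.Bool using (true; false)
open import Data.Nat using (ℕ; zero; suc; _+_; _*_; _∸_; _≤_; _<_; _≟_; _<?_; _≤?_; z≤n; s≤s)
open import Data.Nat.Properties
open import Data.Nat.Tactic.RingSolver using (solve-∀)
open import Data.Vec using (Vec; []; _∷_; head; replicate)
open import Data.Vec.Relation.Binary.Pointwise.Inductive as Pointwise using ([]; _∷_)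
open import Data.List using (List; []; _∷_; _++_; length; map; filter; upTo)
open import Data.List.Properties using (length-++; length-map; length-upTo; filter-++; filter-all; filter-none)
open import Data.List.Membership.Propositional using (_∈_)
open import Data.List.Membership.Propositional.Properties using (∈-map⁺; ∈-map⁻; ∈-++⁺ˡ; ∈-++⁺ʳ; ∈-++⁻; ∈-upTo⁺; ∈-upTo⁻)
open import Data.List.Relation.Unary.All as All using ()
open import Data.List.Relation.Unary.AllPairs using ([]; _∷_)
open import Data.List.Relation.Unary.Any using (here)
open import Data.List.Relation.Unary.Unique.Propositional using (Unique)
import Data.List.Relation.Unary.Unique.Propositional.Properties as Unique
open import Data.Product using (Σ; ∃; _×_; _,_; proj₁; proj₂)
open import Data.Sum using (_⊎_; inj₁; inj₂)
open import Function using (_∘_; mk⇔)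
open import Relation.Nullary using (¬_; does; yes; no; contradiction)
open import Relation.Binary.PropositionalEquality using (_≡_; refl; sym; trans; cong; cong₂; subst; subst₂; module ≡-Reasoning)

-- Finite sums and concatenations

Σ< : (ℕ → ℕ) → ℕ → ℕ
Σ< f zero    = 0
Σ< f (suc n) = f n + Σ< f n

Σ<-cong : ∀ {f g} → (∀ i → f i ≡ g i) → ∀ n → Σ< f n ≡ Σ< g n
Σ<-cong f≗g zero    = refl
Σ<-cong f≗g (suc n) = cong₂ _+_ (f≗g n) (Σ<-cong f≗g n)

Σ<-zero : ∀ {f} → (∀ i → f i ≡ 0) → ∀ n → Σ< f n ≡ 0
Σ<-zero f≗0 zero    = refl
Σ<-zero f≗0 (suc n) = cong₂ _+_ (f≗0 n) (Σ<-zero f≗0 n)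

-- Both sides are the sum of `f` over `0, ..., n`, split off at either end. This is the
-- sliding-window identity behind `H-step`.
Σ<-shift : ∀ f n → Σ< f n + f n ≡ f 0 + Σ< (f ∘ suc) n
Σ<-shift f zero    = +-comm 0 (f 0)
Σ<-shift f (suc n) = begin
  f n + Σ< f n + f (suc n)             ≡⟨ cong (_+ f (suc n)) (+-comm (f n) _) ⟩
  Σ< f n + f n + f (suc n)             ≡⟨ cong (_+ f (suc n)) (Σ<-shift f n) ⟩
  f 0 + Σ< (f ∘ suc) n + f (suc n)     ≡⟨ +-assoc (f 0) _ _ ⟩
  f 0 + (Σ< (f ∘ suc) n + f (suc n))   ≡⟨ cong (f 0 +_) (+-comm _ (f (suc n))) ⟩
  f 0 + (f (suc n) + Σ< (f ∘ suc) n)   ∎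
  where open ≡-Reasoning

module _ {A : Set} where

  concat< : (ℕ → List A) → ℕ → List A
  concat< f zero    = []
  concat< f (suc n) = f n ++ concat< f n

  length-concat< : ∀ f n → length (concat< f n) ≡ Σ< (length ∘ f) n
  length-concat< f zero    = refl
  length-concat< f (suc n) =
    trans (length-++ (f n)) (cong (length (f n) +_) (length-concat< f n))

  ∈-concat<⁺ : ∀ f {n i v} → i < n → v ∈ f i → v ∈ concat< f n
  ∈-concat<⁺ f {suc n} {i} i<1+n v∈ with i ≟ n
  ... | yes refl = ∈-++⁺ˡ v∈
  ... | no i≢n   = ∈-++⁺ʳ (f n) (∈-concat<⁺ f (≤∧≢⇒< (≤-pred i<1+n) i≢n) v∈)

  ∈-concat<⁻ : ∀ f n {v} → v ∈ concat< f n → ∃ λ i → i < n × v ∈ f i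
  ∈-concat<⁻ f (suc n) v∈ with ∈-++⁻ (f n) v∈
  ... | inj₁ v∈f = n , n<1+n n , v∈f
  ... | inj₂ v∈r with i , i<n , v∈f ← ∈-concat<⁻ f n v∈r = i , m<n⇒m<1+n i<n , v∈f

  -- A statistic that equals `i` on block `i` keeps the blocks disjoint, and filtering by its value
  -- recovers a single block. It is applied with the degree, the degree in `x` and `y`, and the
  -- `z`-exponent.
  module _ (f : ℕ → List A) (tag : A → ℕ) (tag≡ : ∀ i {v} → v ∈ f i → tag v ≡ i) where

    concat<-unique : (∀ i → Unique (f i)) → ∀ n → Unique (concat< f n)
    concat<-unique u zero    = []
    concat<-unique u (suc n) = Unique.++⁺ (u n) (concat<-unique u n) λ (v∈f , v∈r) →
      let i , i<n , v∈fi = ∈-concat<⁻ f n v∈r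
      in <⇒≢ i<n (trans (sym (tag≡ i v∈fi)) (tag≡ n v∈f))

    private
      count : ℕ → List A → ℕ
      count j vs = length (filter (λ v → tag v ≟ j) vs)

      count-++ : ∀ j us vs → count j (us ++ vs) ≡ count j us + count j vs
      count-++ j us vs = trans (cong length (filter-++ (λ v → tag v ≟ j) us vs))
                               (length-++ (filter (λ v → tag v ≟ j) us))

      count-same : ∀ j → count j (f j) ≡ length (f j)
      count-same j = cong length (filter-all (λ v → tag v ≟ j) (All.tabulate (tag≡ j)))

      count-other : ∀ i j → ¬ i ≡ j → count j (f i) ≡ 0
      count-other i j i≢j = cong length
        (filter-none (λ v → tag v ≟ j)
          (All.tabulate λ v∈ tag≡j → i≢j (trans (sym (tag≡ i v∈)) tag≡j)))

      count-≥ : ∀ j n → n ≤ j → count j (concat< f n) ≡ 0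
      count-≥ j zero    _   = refl
      count-≥ j (suc n) n<j = trans (count-++ j (f n) _)
        (cong₂ _+_ (count-other n j (<⇒≢ n<j)) (count-≥ j n (<⇒≤ n<j)))

    length-filter-concat< : ∀ j n → j < n →
      length (filter (λ v → tag v ≟ j) (concat< f n)) ≡ length (f j)
    length-filter-concat< j (suc n) j<1+n with n ≟ j
    ... | yes refl = trans (count-++ j (f n) _)
      (trans (cong₂ _+_ (count-same j) (count-≥ j n ≤-refl)) (+-identityʳ _))
    ... | no n≢j   = trans (count-++ j (f n) _)
      (cong₂ _+_ (count-other n j n≢j)
                 (length-filter-concat< j n (≤∧≢⇒< (≤-pred j<1+n) (n≢j ∘ sym))))

prefix : (ℕ → ℕ) → ∀ n → Vec ℕ n
prefix f zero    = []
prefix f (suc n) = f 0 ∷ prefix (f ∘ suc) n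

prefix-! : ∀ f {n i} → i < n → prefix f n ! i ≡ f i
prefix-! f {suc n} {zero}  _         = refl
prefix-! f {suc n} {suc i} (s≤s i<n) = prefix-! (f ∘ suc) i<n

-- Zigzag sequences

module Zigzag (a K : ℕ) (h : Vec ℕ (suc (K * 3 + a)))
  (rise   : ∀ i → i < a → h ! i < h ! suc i)
  (zigzag : ∀ k → k < K →
     h ! (1 + (k * 3 + a)) < h ! (k * 3 + a) ×
     h ! (2 + (k * 3 + a)) ≡ h ! (1 + (k * 3 + a)) ×
     h ! (2 + (k * 3 + a)) < h ! (3 + (k * 3 + a))) where

  private
    e : ℕ
    e = K * 3 + a

  peak : ℕ → ℕ
  peak k = k * 3 + a

  peak-injective : ∀ {k l} → peak k ≡ peak l → k ≡ l
  peak-injective {k} {l} eq = *-cancelʳ-≡ k l 3 (+-cancelʳ-≡ a (k * 3) (l * 3) eq)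

  peak-≤ : ∀ {k} → k ≤ K → peak k ≤ e
  peak-≤ k≤K = +-monoˡ-≤ a (*-monoˡ-≤ 3 k≤K)

  -- Sorts the indices by their local behaviour, so that the maxima are found by cases on the left
  -- end of a run.
  data Position : ℕ → Set where
    initial  : ∀ {i} → i < a → Position i
    top      : ∀ {k} → k < K → Position (peak k)
    valleyˡ  : ∀ {k} → k < K → Position (1 + peak k)
    valleyʳ  : ∀ {k} → k < K → Position (2 + peak k)
    final    : Position e

  next : ∀ {k} → k ≤ K → Position (peak k)
  next {k} k≤K with k ≟ K
  ... | yes refl = final
  ... | no k≢K   = top (≤∧≢⇒< k≤K k≢K)

  position : ∀ i → i ≤ e → Position i
  position zero    _     with 0 <? a
  ... | yes 0<a = initial 0<a
  ... | no 0≮a  = subst Position (n≤0⇒n≡0 (≮⇒≥ 0≮a)) (next z≤n)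
  position (suc i) 1+i≤e with position i (<⇒≤ 1+i≤e)
  ... | top k<K     = valleyˡ k<K
  ... | valleyˡ k<K = valleyʳ k<K
  ... | valleyʳ k<K = next k<K
  ... | final       = contradiction 1+i≤e (<-irrefl refl)
  ... | initial i<a with suc i ≟ a
  ...   | yes refl = next z≤n
  ...   | no 1+i≢a = initial (≤∧≢⇒< i<a 1+i≢a)

  singleton-run : ∀ i b → i ≤ b → ¬ h ! suc i ≡ h ! i →
    (∀ l → i ≤ l → l ≤ b → h ! l ≡ h ! i) → b ≡ i
  singleton-run i b i≤b ne run with b ≟ i
  ... | yes b≡i = b≡i
  ... | no b≢i  = contradiction (run (suc i) (n≤1+n i) (≤∧≢⇒< i≤b (b≢i ∘ sym))) ne

  maximum-at-peak : ∀ i b → IsMaximum h (i , b) → ∃ λ k → k ≤ K × i ≡ peak k × b ≡ peak k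
  maximum-at-peak i b max@(i≤b , b≤e , _) = go (position i (≤-trans i≤b b≤e)) max
    where
    go : ∀ {i b} → Position i → IsMaximum h (i , b) → ∃ λ k → k ≤ K × i ≡ peak k × b ≡ peak k
    go final (e≤b , b≤e , _) = K , ≤-refl , refl , ≤-antisym b≤e e≤b
    go (top {k} k<K) (i≤b , _ , run , _) =
      k , <⇒≤ k<K , refl , singleton-run (peak k) _ i≤b (<⇒≢ (proj₁ (zigzag k k<K))) run
    -- A valley index is a successor, so the alternative `a ≡ 0` is absurd. The step into it goes
    -- down or is flat, so no maximum starts here.
    go (valleyˡ {k} k<K) (_ , _ , _ , inj₂ (_ , refl , up) , _) =
      contradiction up (<-asym (proj₁ (zigzag k k<K)))
    go (valleyʳ {k} k<K) (_ , _ , _ , inj₂ (_ , refl , up) , _) =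
      contradiction up (<-irrefl (sym (proj₁ (proj₂ (zigzag k k<K)))))
    -- A strict rise after `i` makes the run the single index `i`, and the same rise refutes the
    -- condition at its right end.
    go {i} {b} (initial i<a) (i≤b , _ , run , _ , right)
      with singleton-run i b i≤b (<⇒≢ (rise i i<a) ∘ sym) run | right
    ... | refl | inj₁ refl       = contradiction i<a (≤⇒≯ (m≤n+m a (K * 3)))
    ... | refl | inj₂ (_ , down) = contradiction down (<-asym (rise i i<a))

  peak-is-maximum : ∀ k → k ≤ K → IsMaximum h (peak k , peak k)
  peak-is-maximum k k≤K =
    ≤-refl , peak-≤ k≤K , (λ l p≤l l≤p → cong (h !_) (≤-antisym l≤p p≤l)) , left k k≤K , right
    where
    left : ∀ k → k ≤ K → peak k ≡ 0 ⊎ Σ ℕ (λ i → peak k ≡ suc i × h ! i < h ! peak k)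
    left zero    _   with 0 <? a
    ... | no 0≮a  = inj₁ (n≤0⇒n≡0 (≮⇒≥ 0≮a))
    ... | yes 0<a = let 1+i≡a = m+[n∸m]≡n 0<a in
      inj₂ (a ∸ 1 , sym 1+i≡a ,
            subst (λ l → h ! (a ∸ 1) < h ! l) 1+i≡a (rise (a ∸ 1) (≤-reflexive 1+i≡a)))
    left (suc k) k<K = inj₂ (_ , refl , proj₂ (proj₂ (zigzag k k<K)))

    right : peak k ≡ e ⊎ (peak k < e × h ! suc (peak k) < h ! peak k)
    right with k ≟ K
    ... | yes refl = inj₁ refl
    ... | no k≢K   = let k<K = ≤∧≢⇒< k≤K k≢K in
      inj₂ (+-monoˡ-< a (*-monoˡ-< 3 k<K) , proj₁ (zigzag k k<K))

  exactly-maxima : HasExactlyMaxima (suc K) h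
  exactly-maxima =
    map diag (upTo (suc K)) ,
    Unique.map⁺ (peak-injective ∘ cong proj₁) (Unique.upTo⁺ (suc K)) ,
    trans (length-map diag (upTo (suc K))) (length-upTo (suc K)) ,
    λ p → mk⇔ (to p) (from p)
    where
    diag : ℕ → ℕ × ℕ
    diag k = peak k , peak k

    to : ∀ p → p ∈ map diag (upTo (suc K)) → IsMaximum h p
    to p p∈ with k , k∈ , refl ← ∈-map⁻ diag {xs = upTo (suc K)} p∈ = peak-is-maximum k (≤-pred (∈-upTo⁻ k∈))

    from : ∀ p → IsMaximum h p → p ∈ map diag (upTo (suc K))
    from (i , b) max with k , k≤K , refl , refl ← maximum-at-peak i b max =
      ∈-map⁺ diag (∈-upTo⁺ (s≤s k≤K))

  -- The first valley suffices: a turning point beyond `a` contradicts the fall after `a`, and one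
  -- at or before `a` contradicts the rise from `2 + a`.
  not-unimodal : 0 < K → ¬ Unimodal h
  not-unimodal 0<K (j , _ , inc , dec) with zigzag 0 0<K | j ≤? a
  ... | down , _ , _ | no j≰a  = <⇒≱ down (inc a (≰⇒> j≰a))
  ... | _ , _ , up   | yes j≤a = <⇒≱ up (dec (2 + a) (≤-trans j≤a (m≤n+m a 2)) (peak-≤ 0<K))

-- Adding a variable

one : ∀ n → Monomial n
one n = replicate n 0

deg-one : ∀ n → deg (one n) ≡ 0
deg-one zero    = refl
deg-one (suc n) = deg-one n

∣one : ∀ {n} {m : Monomial n} → m ∣ₘ one n → m ≡ one n
∣one {zero}  []           = refl
∣one {suc n} (z≤n ∷ m∣1) = cong (0 ∷_) (∣one m∣1)

∣ₘ-refl : ∀ {n} {m : Monomial n} → m ∣ₘ m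
∣ₘ-refl = Pointwise.refl ≤-refl

deg-mono : ∀ {n} {d m : Monomial n} → d ∣ₘ m → deg d ≤ deg m
deg-mono []        = z≤n
deg-mono (p ∷ ps) = +-mono-≤ p (deg-mono ps)

module AddVariable {n : ℕ} (X : OrderIdeal n) (e : ℕ) (pure : IsPure X e) where

  -- Degree 0 contributes nothing because the unit monomial already comes from `X`.
  power : ℕ → List (Monomial (suc n))
  power zero    = []
  power (suc t) = (suc t ∷ one n) ∷ []

  deg-power : ∀ t {v} → v ∈ power t → deg v ≡ t
  deg-power (suc t) (here refl) = trans (cong (suc t +_) (deg-one n)) (+-identityʳ (suc t))

  power-unique : ∀ t → Unique (power t)
  power-unique zero    = []
  power-unique (suc t) = All.[] ∷ []

  powers : List (Monomial (suc n))
  powers = concat< power (suc e)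

  ∈-powers⁻ : ∀ {a m} → (a ∷ m) ∈ powers → 0 < a × a ≤ e × m ≡ one n
  ∈-powers⁻ v∈ with ∈-concat<⁻ power (suc e) v∈
  ... | suc t , s≤s t<e , here refl = s≤s z≤n , t<e , refl

  ∈-powers⁺ : ∀ {a} → 0 < a → a ≤ e → (a ∷ one n) ∈ powers
  ∈-powers⁺ {suc t} _ a≤e = ∈-concat<⁺ power (s≤s a≤e) (here refl)

  elems′ : List (Monomial (suc n))
  elems′ = map (0 ∷_) (elems X) ++ powers

  one∈ : one n ∈ elems X
  one∈ = closed X _ (proj₂ (nonempty X)) _ (one∣ _)
    where
    one∣ : ∀ {n} (m : Monomial n) → one n ∣ₘ m
    one∣ []      = []
    one∣ (x ∷ m) = z≤n ∷ one∣ m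

  closed′ : ∀ m → m ∈ elems′ → ∀ d → d ∣ₘ m → d ∈ elems′
  closed′ m m∈ d d∣m with ∈-++⁻ (map (0 ∷_) (elems X)) m∈
  closed′ _ _ (a ∷ d) d∣m | inj₁ m∈l with m , m∈X , refl ← ∈-map⁻ (0 ∷_) m∈l with z≤n ∷ d∣ ← d∣m =
    ∈-++⁺ˡ (∈-map⁺ (0 ∷_) (closed X m m∈X d d∣))
  closed′ (_ ∷ _) _ (a ∷ d) (a≤b ∷ d∣) | inj₂ m∈p with _ , b≤e , refl ← ∈-powers⁻ m∈p with refl ← ∣one d∣ with a
  ... | zero  = ∈-++⁺ˡ (∈-map⁺ (0 ∷_) one∈)
  ... | suc t = ∈-++⁺ʳ (map (0 ∷_) (elems X)) (∈-powers⁺ (s≤s z≤n) (≤-trans a≤b b≤e))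

  ideal : OrderIdeal (suc n)
  ideal = record
    { elems    = elems′
    ; unique   = Unique.++⁺ (Unique.map⁺ (λ { refl → refl }) (unique X))
                            (concat<-unique power deg deg-power power-unique (suc e))
                            disjoint
    ; nonempty = _ , ∈-++⁺ˡ (∈-map⁺ (0 ∷_) one∈)
    ; closed   = closed′
    }
    where
    disjoint : ∀ {v} → ¬ (v ∈ map (0 ∷_) (elems X) × v ∈ powers)
    disjoint (v∈l , v∈p) with _ , _ , refl ← ∈-map⁻ (0 ∷_) v∈l with () ← proj₁ (∈-powers⁻ v∈p)

  ideal-pure : IsPure ideal e
  ideal-pure m (m∈ , max) with ∈-++⁻ (map (0 ∷_) (elems X)) m∈
  ... | inj₁ m∈l with m₀ , m₀∈ , refl ← ∈-map⁻ (0 ∷_) m∈l =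
    pure m₀ (m₀∈ , λ m' m'∈ m₀∣m' → tail-≡ (max (0 ∷ m') (∈-++⁺ˡ (∈-map⁺ (0 ∷_) m'∈)) (z≤n ∷ m₀∣m')))
    where
    tail-≡ : ∀ {k l : Monomial n} → (0 ∷ k) ≡ (0 ∷ l) → k ≡ l
    tail-≡ refl = refl
  ideal-pure (zero ∷ m) _ | inj₂ m∈p with () ← proj₁ (∈-powers⁻ m∈p)
  -- Every listed power divides the `e`-th one, so maximality forces equality with it.
  ideal-pure (suc t ∷ m) (_ , max) | inj₂ m∈p with _ , t<e , refl ← ∈-powers⁻ m∈p =
    trans (cong deg (sym (max _ (∈-++⁺ʳ (map (0 ∷_) (elems X)) (∈-powers⁺ (≤-trans (s≤s z≤n) t<e) ≤-refl)) (t<e ∷ ∣ₘ-refl))))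
          (trans (cong (e +_) (deg-one n)) (+-identityʳ e))

  count-map-0∷ : ∀ j (ms : List (Monomial n)) →
    length (filter (λ m → deg m ≟ j) (map (0 ∷_) ms)) ≡ length (filter (λ m → deg m ≟ j) ms)
  count-map-0∷ j []       = refl
  count-map-0∷ j (m ∷ ms) with does (deg m ≟ j)
  ... | true  = cong suc (count-map-0∷ j ms)
  ... | false = count-map-0∷ j ms

  countDeg-ideal : ∀ j → j ≤ e → countDeg ideal j ≡ countDeg X j + length (power j)
  countDeg-ideal j j≤e = begin
    length (filter P? elems′)                                                ≡⟨ cong length (filter-++ P? (map (0 ∷_) (elems X)) powers) ⟩
    length (filter P? (map (0 ∷_) (elems X)) ++ filter P? powers)            ≡⟨ length-++ (filter P? (map (0 ∷_) (elems X))) ⟩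
    length (filter P? (map (0 ∷_) (elems X))) + length (filter P? powers)    ≡⟨ cong₂ _+_ (count-map-0∷ j (elems X))
                                                                                  (length-filter-concat< power deg deg-power j (suc e) (s≤s j≤e)) ⟩
    countDeg X j + length (power j)                                          ∎
    where
    open ≡-Reasoning
    P? = λ (m : Monomial (suc n)) → deg m ≟ j

-- The construction in three variables

width : ℕ → ℕ
width (suc (suc (suc v))) = 3 + width v
width _                   = 3

width-≤ : ∀ v → width v ≤ 3 + v
width-≤ 0                   = ≤-refl
width-≤ 1                   = m≤m+n 3 1
width-≤ 2                   = m≤m+n 3 2
width-≤ (suc (suc (suc v))) = +-monoʳ-≤ 3 (width-≤ v)

3≤width : ∀ v → 3 ≤ width v
3≤width 0                   = ≤-refl
3≤width 1                   = ≤-refl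
3≤width 2                   = ≤-refl
3≤width (suc (suc (suc v))) = m≤m+n 3 (width v)

width-mono : ∀ {u v} → u ≤ v → width u ≤ width v
width-mono {0} {v} _ = 3≤width v
width-mono {1} {v} _ = 3≤width v
width-mono {2} {v} _ = 3≤width v
width-mono {suc (suc (suc u))} (s≤s (s≤s (s≤s u≤v))) = +-monoʳ-≤ 3 (width-mono u≤v)

-- Compared with `v + 2`, the width is larger by 1, equal, or smaller by 1 as `v` is 0, 1 or 2
-- modulo 3. The next two lemmas give the other residues.
width-3l : ∀ l → width (l * 3) ≡ 3 + l * 3
width-3l zero    = refl
width-3l (suc l) = cong (3 +_) (width-3l l)

width-1+3l : ∀ l → width (1 + l * 3) ≡ 3 + l * 3
width-1+3l zero    = refl
width-1+3l (suc l) = cong (3 +_) (width-1+3l l)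

width-2+3l : ∀ l → width (2 + l * 3) ≡ 3 + l * 3
width-2+3l zero    = refl
width-2+3l (suc l) = cong (3 +_) (width-2+3l l)

module Construction (N : ℕ) where

  -- `G` bounds `width (e ∸ s)` for all `s ≥ A`, where `e ∸ s` is at most `N + N`. With `A = G + N`,
  -- box monomials of `x,y`-degree `s ≥ A` have `x ≥ s ∸ N ≥ G` and so avoid the cylinder. The
  -- lowest peak is at `a`; writing `e` as `N + a` makes it definitionally the `K * 3 + a` of
  -- `Zigzag` when `N = K * 3`.
  G A a e : ℕ
  G = 3 + (N + N)
  A = G + N
  a = A + N
  e = N + a

  e≡A+N+N : e ≡ A + (N + N)
  e≡A+N+N = trans (+-comm N a) (+-assoc A N N)

  -- The number of cylinder columns over `x,y`-degree `s`: below `A` all `s + 1` monomials in `x`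
  -- and `y` occur, from `A` on only those with small `x`-exponent.
  rowWidth : ℕ → ℕ
  rowWidth s with s <? A
  ... | yes _ = suc s
  ... | no _  = width (e ∸ s)

  width-bound : ∀ {s} → A ≤ s → width (e ∸ s) ≤ G
  width-bound {s} A≤s = ≤-trans (width-≤ (e ∸ s)) (+-monoʳ-≤ 3 (m≤n+o⇒m∸n≤o e s
    (≤-trans (≤-reflexive e≡A+N+N) (+-monoˡ-≤ (N + N) A≤s))))

  rowWidth-high : ∀ {s} → A ≤ s → rowWidth s ≡ width (e ∸ s)
  rowWidth-high {s} A≤s with s <? A
  ... | yes s<A = contradiction A≤s (<⇒≱ s<A)
  ... | no _    = refl

  0<rowWidth : ∀ s → 0 < rowWidth s
  0<rowWidth s with s <? A
  ... | yes _ = s≤s z≤n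
  ... | no _  = ≤-trans (s≤s z≤n) (3≤width (e ∸ s))

  -- For `s ≥ A` the width is at most `G ≤ A ≤ s`. Hence `x ≤ s` in every row, and the `y`-exponent
  -- `s ∸ x` is never truncated.
  <rowWidth⁻ : ∀ {x s} → x < rowWidth s → x ≤ s × (s < A ⊎ x < width (e ∸ s))
  <rowWidth⁻ {x} {s} x<w with s <? A
  ... | yes s<A = ≤-pred x<w , inj₁ s<A
  ... | no s≮A  = let A≤s = ≮⇒≥ s≮A in
    ≤-trans (<⇒≤ x<w) (≤-trans (width-bound A≤s) (≤-trans (m≤m+n G N) A≤s)) , inj₂ x<w

  <rowWidth⁺ : ∀ {x s} → x ≤ s → s < A ⊎ x < width (e ∸ s) → x < rowWidth s
  <rowWidth⁺ {x} {s} x≤s c with s <? A | c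
  ... | yes _  | _        = s≤s x≤s
  ... | no s≮A | inj₁ s<A = contradiction s<A s≮A
  ... | no _   | inj₂ x<w = x<w

  -- The x-exponents, at x,y-degree s, of the part of the box outside the cylinder.
  boxRow : ℕ → List ℕ
  boxRow s with s <? A
  ... | yes _ = []
  ... | no _  = map (s ∸ N +_) (upTo (suc A ∸ (s ∸ N)))

  ∈-boxRow⁻ : ∀ {x s} → x ∈ boxRow s → A ≤ s × s ∸ N ≤ x × x ≤ A
  ∈-boxRow⁻ {x} {s} x∈ with s <? A
  ... | no s≮A with t , t∈ , refl ← ∈-map⁻ (s ∸ N +_) x∈ =
    ≮⇒≥ s≮A , m≤m+n (s ∸ N) t , ≤-pred (subst (s ∸ N + t <_) (m+[n∸m]≡n c≤1+A) (+-monoʳ-< (s ∸ N) t<))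
    where
    t<    = ∈-upTo⁻ t∈
    c≤1+A = <⇒≤ (m∸n≢0⇒n<m {suc A} {s ∸ N} (m<n⇒n≢0 t<))

  ∈-boxRow⁺ : ∀ {x s} → A ≤ s → s ∸ N ≤ x → x ≤ A → x ∈ boxRow s
  ∈-boxRow⁺ {x} {s} A≤s c≤x x≤A with s <? A
  ... | yes s<A = contradiction A≤s (<⇒≱ s<A)
  ... | no _    = subst (_∈ map (s ∸ N +_) (upTo (suc A ∸ (s ∸ N)))) (m+[n∸m]≡n c≤x)
    (∈-map⁺ (s ∸ N +_) (∈-upTo⁺ (∸-monoˡ-< (s≤s x≤A) c≤x)))

  boxRow-unique : ∀ s → Unique (boxRow s)
  boxRow-unique s with s <? A
  ... | yes _ = []
  ... | no _  = Unique.map⁺ (+-cancelˡ-≡ (s ∸ N) _ _) (Unique.upTo⁺ _)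

  length-boxRow-low : ∀ {s} → s < A → length (boxRow s) ≡ 0
  length-boxRow-low {s} s<A with s <? A
  ... | yes _  = refl
  ... | no s≮A = contradiction s<A s≮A

  length-boxRow-high : ∀ {s} → A ≤ s → length (boxRow s) ≡ suc A ∸ (s ∸ N)
  length-boxRow-high {s} A≤s with s <? A
  ... | yes s<A = contradiction A≤s (<⇒≱ s<A)
  ... | no _    = trans (length-map (s ∸ N +_) (upTo (suc A ∸ (s ∸ N)))) (length-upTo _)

  -- Monomials of a fixed degree

  mono : ℕ → ℕ → ℕ → Monomial 3
  mono s z x = x ∷ s ∸ x ∷ z ∷ []

  mono-injective : ∀ s z {x x'} → mono s z x ≡ mono s z x' → x ≡ x'
  mono-injective s z eq = cong head eq

  -- Degree `j` is sliced by `x,y`-degree in the cylinder, where `z` is then determined, but by `z`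
  -- in the box. The bound `z ≤ N` turns the box count into a sum over a window of constant length.
  cylinderRow boxSlice : ℕ → ℕ → List (Monomial 3)
  cylinderRow j s = map (mono s (j ∸ s)) (upTo (rowWidth s))
  boxSlice    j z = map (mono (j ∸ z) z) (boxRow (j ∸ z))

  cylinderDeg boxDeg elemsDeg : ℕ → List (Monomial 3)
  cylinderDeg j = concat< (cylinderRow j) (suc j)
  boxDeg      j = concat< (boxSlice j) (suc N)
  elemsDeg    j = cylinderDeg j ++ boxDeg j

  xy-deg z-deg : Monomial 3 → ℕ
  xy-deg (x ∷ y ∷ _) = x + y
  z-deg (_ ∷ _ ∷ z ∷ []) = z

  cylinderRow-tag : ∀ j s {v} → v ∈ cylinderRow j s → xy-deg v ≡ s
  cylinderRow-tag j s v∈ with x , x∈ , refl ← ∈-map⁻ (mono s (j ∸ s)) v∈ =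
    m+[n∸m]≡n (proj₁ (<rowWidth⁻ (∈-upTo⁻ x∈)))

  boxSlice-tag : ∀ j z {v} → v ∈ boxSlice j z → z-deg v ≡ z
  boxSlice-tag j z v∈ with _ , _ , refl ← ∈-map⁻ (mono (j ∸ z) z) v∈ = refl

  deg-assoc : ∀ x y z → x + (y + (z + 0)) ≡ x + y + z
  deg-assoc = solve-∀

  ∈-cylinderDeg⁻ : ∀ {j x y z} → (x ∷ y ∷ z ∷ []) ∈ cylinderDeg j →
    deg (x ∷ y ∷ z ∷ []) ≡ j × x < rowWidth (x + y)
  ∈-cylinderDeg⁻ {j} v∈ with s , s≤j , v∈s ← ∈-concat<⁻ (cylinderRow j) (suc j) v∈
    with x , x∈ , refl ← ∈-map⁻ (mono s (j ∸ s)) v∈s =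
    trans (deg-assoc x (s ∸ x) (j ∸ s)) (trans (cong (_+ (j ∸ s)) x+y≡s) (m+[n∸m]≡n (≤-pred s≤j))) ,
    subst (λ t → x < rowWidth t) (sym x+y≡s) x<w
    where
    x<w   = ∈-upTo⁻ x∈
    x+y≡s = m+[n∸m]≡n (proj₁ (<rowWidth⁻ x<w))

  ∈-boxDeg⁻ : ∀ {j x y z} → (x ∷ y ∷ z ∷ []) ∈ boxDeg j →
    deg (x ∷ y ∷ z ∷ []) ≡ j × A ≤ x + y × x ≤ A × x + y ∸ N ≤ x × z ≤ N
  ∈-boxDeg⁻ {j} v∈ with z , z≤N , v∈z ← ∈-concat<⁻ (boxSlice j) (suc N) v∈
    with x , x∈ , refl ← ∈-map⁻ (mono (j ∸ z) z) v∈z with A≤s , c≤x , x≤A ← ∈-boxRow⁻ x∈ =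
    trans (deg-assoc x (j ∸ z ∸ x) z) (trans (cong (_+ z) x+y≡s) (m∸n+n≡m z≤j)) ,
    subst (A ≤_) (sym x+y≡s) A≤s , x≤A , subst (λ t → t ∸ N ≤ x) (sym x+y≡s) c≤x , ≤-pred z≤N
    where
    -- A box row is inhabited only when `j ∸ z ≥ A > 0`, so the subtraction is not truncated.
    z≤j   = <⇒≤ (m∸n≢0⇒n<m {j} {z} (m<n⇒n≢0 A≤s))
    x+y≡s = m+[n∸m]≡n (≤-trans x≤A A≤s)

  ∈-cylinderDeg⁺ : ∀ {x y z} → x < rowWidth (x + y) →
    (x ∷ y ∷ z ∷ []) ∈ cylinderDeg (deg (x ∷ y ∷ z ∷ []))
  ∈-cylinderDeg⁺ {x} {y} {z} x<w =
    ∈-concat<⁺ (cylinderRow j) (s≤s (≤-trans (m≤m+n (x + y) z) (≤-reflexive (sym j≡))))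
      (subst (_∈ cylinderRow j (x + y))
        (cong₂ (λ y z → x ∷ y ∷ z ∷ []) (m+n∸m≡n x y) (trans (cong (_∸ (x + y)) j≡) (m+n∸m≡n (x + y) z)))
        (∈-map⁺ (mono (x + y) (j ∸ (x + y))) (∈-upTo⁺ x<w)))
    where
    j  = deg (x ∷ y ∷ z ∷ [])
    j≡ = deg-assoc x y z

  ∈-boxDeg⁺ : ∀ {x y z} → A ≤ x + y → x ≤ A → y ≤ N → z ≤ N →
    (x ∷ y ∷ z ∷ []) ∈ boxDeg (deg (x ∷ y ∷ z ∷ []))
  ∈-boxDeg⁺ {x} {y} {z} A≤s x≤A y≤N z≤N =
    ∈-concat<⁺ (boxSlice j) (s≤s z≤N)
      (subst (_∈ boxSlice j z)
        (cong (λ y → x ∷ y ∷ z ∷ []) (trans (cong (_∸ x) s≡) (m+n∸m≡n x y)))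
        (∈-map⁺ (mono (j ∸ z) z) (subst (λ s → x ∈ boxRow s) (sym s≡) x∈)))
    where
    j  = deg (x ∷ y ∷ z ∷ [])
    s≡ : j ∸ z ≡ x + y
    s≡ = trans (cong (_∸ z) (deg-assoc x y z)) (m+n∸n≡m (x + y) z)
    x∈ : x ∈ boxRow (x + y)
    x∈ = ∈-boxRow⁺ A≤s
      (m≤n+o⇒m∸n≤o (x + y) N (≤-trans (+-monoʳ-≤ x y≤N) (≤-reflexive (+-comm x N)))) x≤A

  elemsDeg-tag : ∀ j {v} → v ∈ elemsDeg j → deg v ≡ j
  elemsDeg-tag j {_ ∷ _ ∷ _ ∷ []} v∈ with ∈-++⁻ (cylinderDeg j) v∈
  ... | inj₁ v∈c = proj₁ (∈-cylinderDeg⁻ {j} v∈c)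
  ... | inj₂ v∈b = proj₁ (∈-boxDeg⁻ {j} v∈b)

  elemsDeg-unique : ∀ j → Unique (elemsDeg j)
  elemsDeg-unique j = Unique.++⁺
    (concat<-unique (cylinderRow j) xy-deg (cylinderRow-tag j)
      (λ s → Unique.map⁺ (mono-injective s (j ∸ s)) (Unique.upTo⁺ (rowWidth s))) (suc j))
    (concat<-unique (boxSlice j) z-deg (boxSlice-tag j)
      (λ z → Unique.map⁺ (mono-injective (j ∸ z) z) (boxRow-unique (j ∸ z))) (suc N))
    disjoint
    where
    disjoint : ∀ {v} → ¬ (v ∈ cylinderDeg j × v ∈ boxDeg j)
    -- The cylinder would give `x < G`, the box `x ≥ A ∸ N = G`.
    disjoint {x ∷ y ∷ z ∷ []} (v∈c , v∈b)
      with _ , x<w ← ∈-cylinderDeg⁻ {j} v∈c | _ , A≤s , _ , c≤x , _ ← ∈-boxDeg⁻ {j} v∈b =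
      <⇒≱ (subst (x <_) (rowWidth-high A≤s) x<w)
        (≤-trans (width-bound A≤s)
          (≤-trans (≤-reflexive (sym (m+n∸n≡m G N))) (≤-trans (∸-monoˡ-≤ N A≤s) c≤x)))

  -- The order ideal and its purity

  Member : ℕ → ℕ → ℕ → Set
  Member x y z = deg (x ∷ y ∷ z ∷ []) ≤ e ×
    ((x + y < A ⊎ x < width (e ∸ (x + y))) ⊎ (x ≤ A × y ≤ N × z ≤ N))

  members : List (Monomial 3)
  members = concat< elemsDeg (suc e)

  ∈-members⁻ : ∀ {x y z} → (x ∷ y ∷ z ∷ []) ∈ members → Member x y z
  ∈-members⁻ {x} {y} v∈ with j , j≤e , v∈j ← ∈-concat<⁻ elemsDeg (suc e) v∈ | ∈-++⁻ (cylinderDeg j) v∈j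
  ... | inj₁ v∈c with refl , x<w ← ∈-cylinderDeg⁻ {j} v∈c = ≤-pred j≤e , inj₁ (proj₂ (<rowWidth⁻ x<w))
  ... | inj₂ v∈b with refl , _ , x≤A , c≤x , z≤N ← ∈-boxDeg⁻ {j} v∈b =
    ≤-pred j≤e , inj₂ (x≤A , +-cancelˡ-≤ x y N (m∸n≤o⇒m≤o+n c≤x) , z≤N)
    where
    m∸n≤o⇒m≤o+n : ∀ {m n o} → m ∸ n ≤ o → m ≤ o + n
    m∸n≤o⇒m≤o+n {m} {n} m∸n≤o =
      ≤-trans (m≤n+m∸n m n) (≤-trans (≤-reflexive (+-comm n (m ∸ n))) (+-monoˡ-≤ n m∸n≤o))

  -- `Member` admits the whole box, which makes closure under divisors visible, whereas the list
  -- takes from the box only `x,y`-degrees at least `A`. The remaining box monomials are listed with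
  -- the cylinder.
  ∈-members⁺ : ∀ {x y z} → Member x y z → (x ∷ y ∷ z ∷ []) ∈ members
  ∈-members⁺ {x} {y} {z} (d≤e , c) = ∈-concat<⁺ elemsDeg (s≤s d≤e) (go c)
    where
    cyl : x + y < A ⊎ x < width (e ∸ (x + y)) → (x ∷ y ∷ z ∷ []) ∈ elemsDeg (deg (x ∷ y ∷ z ∷ []))
    cyl c = ∈-++⁺ˡ (∈-cylinderDeg⁺ (<rowWidth⁺ (m≤m+n x y) c))

    go : (x + y < A ⊎ x < width (e ∸ (x + y))) ⊎ (x ≤ A × y ≤ N × z ≤ N) →
      (x ∷ y ∷ z ∷ []) ∈ elemsDeg (deg (x ∷ y ∷ z ∷ []))
    go (inj₁ c) = cyl c
    go (inj₂ (x≤A , y≤N , z≤N)) with x + y <? A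
    ... | yes s<A = cyl (inj₁ s<A)
    ... | no s≮A  = ∈-++⁺ʳ (cylinderDeg (deg (x ∷ y ∷ z ∷ []))) (∈-boxDeg⁺ (≮⇒≥ s≮A) x≤A y≤N z≤N)

  members-closed : ∀ m → m ∈ members → ∀ d → d ∣ₘ m → d ∈ members
  members-closed (x ∷ y ∷ z ∷ []) m∈ (x' ∷ y' ∷ z' ∷ []) d∣m@(x'≤x ∷ y'≤y ∷ z'≤z ∷ [])
    with d≤e , c ← ∈-members⁻ m∈ = ∈-members⁺ (≤-trans (deg-mono d∣m) d≤e , go c)
    where
    s'≤s : x' + y' ≤ x + y
    s'≤s = +-mono-≤ x'≤x y'≤y

    go : (x + y < A ⊎ x < width (e ∸ (x + y))) ⊎ (x ≤ A × y ≤ N × z ≤ N) →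
      (x' + y' < A ⊎ x' < width (e ∸ (x' + y'))) ⊎ (x' ≤ A × y' ≤ N × z' ≤ N)
    go (inj₁ (inj₁ s<A)) = inj₁ (inj₁ (≤-<-trans s'≤s s<A))
    -- Passing to a divisor can only increase `e ∸ (x + y)`, and `width` is monotone.
    go (inj₁ (inj₂ x<w)) = inj₁ (inj₂ (≤-<-trans x'≤x (<-≤-trans x<w (width-mono (∸-monoʳ-≤ e s'≤s)))))
    go (inj₂ (x≤A , y≤N , z≤N)) = inj₂ (≤-trans x'≤x x≤A , ≤-trans y'≤y y≤N , ≤-trans z'≤z z≤N)

  ideal : OrderIdeal 3
  ideal = record
    { elems    = members
    ; unique   = concat<-unique elemsDeg deg elemsDeg-tag elemsDeg-unique (suc e)
    ; nonempty = (0 ∷ 0 ∷ 0 ∷ []) , ∈-members⁺ (z≤n , inj₁ (inj₁ (s≤s z≤n)))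
    ; closed   = members-closed
    }

  -- The cylinder conditions ignore `z`, so a cylinder monomial of degree below `e` can be
  -- multiplied by `z`. A box monomial divides the corner with exponents `A`, `N`, `N`, whose degree
  -- is `e`.
  ideal-pure : IsPure ideal e
  ideal-pure (x ∷ y ∷ z ∷ []) (m∈ , max) with d≤e , c ← ∈-members⁻ m∈ = go c
    where
    go : (x + y < A ⊎ x < width (e ∸ (x + y))) ⊎ (x ≤ A × y ≤ N × z ≤ N) → deg (x ∷ y ∷ z ∷ []) ≡ e
    go (inj₁ c) with deg (x ∷ y ∷ z ∷ []) ≟ e
    ... | yes d≡e = d≡e
    ... | no d≢e  = contradiction
      (cong z-deg (max (x ∷ y ∷ suc z ∷ [])
        (∈-members⁺ (≤-trans (≤-reflexive (deg-suc x y z)) (≤∧≢⇒< d≤e d≢e) , inj₁ c))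
        (≤-refl ∷ ≤-refl ∷ n≤1+n z ∷ [])))
      1+n≢n
      where
      deg-suc : ∀ x y z → x + (y + (suc z + 0)) ≡ suc (x + (y + (z + 0)))
      deg-suc = solve-∀
    go (inj₂ (x≤A , y≤N , z≤N)) = trans (cong deg (sym corner≡)) deg-corner
      where
      deg-corner : deg (A ∷ N ∷ N ∷ []) ≡ e
      deg-corner = trans (deg-assoc A N N) (trans (+-assoc A N N) (sym e≡A+N+N))

      corner≡ : (A ∷ N ∷ N ∷ []) ≡ (x ∷ y ∷ z ∷ [])
      corner≡ = max _ (∈-members⁺ (≤-reflexive deg-corner , inj₂ (≤-refl , ≤-refl , ≤-refl)))
                    (x≤A ∷ y≤N ∷ z≤N ∷ [])

  -- The Hilbert function and its steps

  H : ℕ → ℕ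
  H j = Σ< rowWidth (suc j) + Σ< (λ z → length (boxRow (j ∸ z))) (suc N)

  countDeg-ideal : ∀ j → j ≤ e → countDeg ideal j ≡ H j
  countDeg-ideal j j≤e = begin
    countDeg ideal j                            ≡⟨ length-filter-concat< elemsDeg deg elemsDeg-tag j (suc e) (s≤s j≤e) ⟩
    length (cylinderDeg j ++ boxDeg j)          ≡⟨ length-++ (cylinderDeg j) ⟩
    length (cylinderDeg j) + length (boxDeg j)  ≡⟨ cong₂ _+_ cyl box ⟩
    H j                                         ∎
    where
    open ≡-Reasoning
    cyl : length (cylinderDeg j) ≡ Σ< rowWidth (suc j)
    cyl = trans (length-concat< (cylinderRow j) (suc j))
      (Σ<-cong (λ s → trans (length-map _ (upTo (rowWidth s))) (length-upTo (rowWidth s))) (suc j))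
    box : length (boxDeg j) ≡ Σ< (λ z → length (boxRow (j ∸ z))) (suc N)
    box = trans (length-concat< (boxSlice j) (suc N)) (Σ<-cong (λ z → length-map _ (boxRow (j ∸ z))) (suc N))

  -- In degree `j + 1` a cylinder row and a box row begin, while the box columns over `x,y`-degree
  -- `j ∸ N` have reached `z = N` and end. The loss is added on the left to avoid subtraction.
  H-step : ∀ j → H (suc j) + length (boxRow (j ∸ N)) ≡ H j + (rowWidth (suc j) + length (boxRow (suc j)))
  H-step j = begin
    (w + P) + W' + ρ        ≡⟨ +-assoc (w + P) W' ρ ⟩
    (w + P) + (W' + ρ)      ≡⟨ cong ((w + P) +_) (Σ<-shift (λ z → length (boxRow (suc j ∸ z))) (suc N)) ⟩
    (w + P) + (ρ' + W)      ≡⟨ rearrange w P ρ' W ⟩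
    (P + W) + (w + ρ')      ∎
    where
    open ≡-Reasoning
    w  = rowWidth (suc j)
    P  = Σ< rowWidth (suc j)
    W' = Σ< (λ z → length (boxRow (suc j ∸ z))) (suc N)
    W  = Σ< (λ z → length (boxRow (j ∸ z))) (suc N)
    ρ  = length (boxRow (j ∸ N))
    ρ' = length (boxRow (suc j))
    rearrange : ∀ w P ρ' W → (w + P) + (ρ' + W) ≡ (P + W) + (w + ρ')
    rearrange = solve-∀

  -- Before degree `a = A + N` no box column has ended, and each new cylinder row is nonempty.
  H-rise : ∀ j → j < a → H j < H (suc j)
  H-rise j j<a = begin-strict
    H j                                                     <⟨ m<m+n (H j) (≤-trans (0<rowWidth (suc j)) (m≤m+n _ _)) ⟩
    H j + (rowWidth (suc j) + length (boxRow (suc j)))      ≡⟨ H-step j ⟨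
    H (suc j) + length (boxRow (j ∸ N))                     ≡⟨ cong (H (suc j) +_) (length-boxRow-low j∸N<A) ⟩
    H (suc j) + 0                                           ≡⟨ +-identityʳ _ ⟩
    H (suc j)                                               ∎
    where
    open ≤-Reasoning
    j∸N<A : j ∸ N < A
    j∸N<A = m<n+o⇒m∸n<o j N (<-≤-trans j<a (≤-reflexive (+-comm A N)))

  -- Passing from degree j = e - 1 - v to j + 1, the cylinder gains width v columns and the box loses v + 2.
  H-zigzag : ∀ j v → v < N → suc v + j ≡ e → H (suc j) + (2 + v) ≡ H j + width v
  H-zigzag j v v<N eq = begin
    H (suc j) + (2 + v)                                   ≡⟨ cong (H (suc j) +_) lost ⟨
    H (suc j) + length (boxRow (j ∸ N))                   ≡⟨ H-step j ⟩
    H j + (rowWidth (suc j) + length (boxRow (suc j)))    ≡⟨ cong (H j +_) gained ⟩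
    H j + width v                                         ∎
    where
    open ≡-Reasoning
    i = N ∸ suc v

    j≡ : j ≡ i + a
    j≡ = +-cancelˡ-≡ (suc v) j (i + a) (begin
      suc v + j          ≡⟨ eq ⟩
      N + a              ≡⟨ cong (_+ a) (m+[n∸m]≡n v<N) ⟨
      suc v + i + a      ≡⟨ +-assoc (suc v) i a ⟩
      suc v + (i + a)    ∎)

    j∸N≡ : j ∸ N ≡ i + A
    j∸N≡ = trans (cong (_∸ N) (trans j≡ (sym (+-assoc i A N)))) (m+n∸n≡m (i + A) N)

    A∸≡ : i + A ∸ N ≡ A ∸ suc v
    A∸≡ = begin
      i + A ∸ N            ≡⟨ cong (i + A ∸_) (m∸n+n≡m v<N) ⟨
      i + A ∸ (i + suc v)  ≡⟨ ∸-+-assoc (i + A) i (suc v) ⟨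
      i + A ∸ i ∸ suc v    ≡⟨ cong (_∸ suc v) (m+n∸m≡n i A) ⟩
      A ∸ suc v            ∎

    -- In the row that ends, `x` runs from `A ∸ suc v` to `A`, which gives `v + 2` values.
    lost : length (boxRow (j ∸ N)) ≡ 2 + v
    lost = begin
      length (boxRow (j ∸ N))   ≡⟨ cong (length ∘ boxRow) j∸N≡ ⟩
      length (boxRow (i + A))   ≡⟨ length-boxRow-high (m≤n+m A i) ⟩
      suc A ∸ (i + A ∸ N)       ≡⟨ cong (suc A ∸_) A∸≡ ⟩
      suc A ∸ (suc A ∸ (2 + v)) ≡⟨ m∸[m∸n]≡n (s≤s (≤-trans v<N (m≤n+m N G))) ⟩
      2 + v                     ∎

    A≤1+j : A ≤ suc j
    A≤1+j = ≤-trans (m≤m+n A N) (≤-trans (m≤n+m a (suc i)) (≤-reflexive (cong suc (sym j≡))))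

    e∸≡ : e ∸ suc j ≡ v
    e∸≡ = trans (cong (_∸ suc j) (trans (sym eq) (sym (+-suc v j)))) (m+n∸n≡m v (suc j))

    -- The `x,y`-degree `suc j` exceeds `A + N`, so the new box row is empty and only the cylinder
    -- gains.
    gained : rowWidth (suc j) + length (boxRow (suc j)) ≡ width v
    gained = begin
      rowWidth (suc j) + length (boxRow (suc j))
        ≡⟨ cong₂ _+_ (rowWidth-high A≤1+j) (length-boxRow-high A≤1+j) ⟩
      width (e ∸ suc j) + (suc A ∸ (suc j ∸ N))
        ≡⟨ cong₂ _+_ (cong width e∸≡) (m≤n⇒m∸n≡0 1+A≤) ⟩
      width v + 0
        ≡⟨ +-identityʳ _ ⟩
      width v ∎
      where
      1+A≤ : suc A ≤ suc j ∸ N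
      1+A≤ = m+n≤o⇒m≤o∸n (suc A) (s≤s (≤-trans (m≤n+m a i) (≤-reflexive (sym j≡))))

  -- Three consecutive uses of `H-zigzag`, with `v` equal to `2 + l * 3`, `1 + l * 3` and `l * 3`,
  -- give the changes -1, 0, +1.
  H-valley : ∀ j l → 3 + l * 3 ≤ N → 3 + (l * 3 + j) ≡ e →
    suc (H (1 + j)) ≡ H j × H (2 + j) ≡ H (1 + j) × H (3 + j) ≡ suc (H (2 + j))
  H-valley j l l< eq =
    +-cancelʳ-≡ (3 + l * 3) _ _
      (trans (sym (+-suc (H (1 + j)) (3 + l * 3)))
        (trans (H-zigzag j (2 + l * 3) l< eq) (cong (H j +_) (width-2+3l l)))) ,
    +-cancelʳ-≡ (3 + l * 3) _ _
      (trans (H-zigzag (1 + j) (1 + l * 3) (<⇒≤ l<) (trans (cong (2 +_) (+-suc (l * 3) j)) eq))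
        (cong (H (1 + j) +_) (width-1+3l l))) ,
    +-cancelʳ-≡ (2 + l * 3) _ _
      (trans (H-zigzag (2 + j) (l * 3) (<⇒≤ (<⇒≤ l<))
               (trans (cong suc (trans (+-suc (l * 3) (1 + j)) (cong suc (+-suc (l * 3) j)))) eq))
        (trans (cong (H (2 + j) +_) (width-3l l)) (+-suc (H (2 + j)) (2 + l * 3))))

  H-1 : H 1 ≡ 3
  H-1 = cong (3 +_) (Σ<-zero (λ z → length-boxRow-low (≤-<-trans (m∸n≤m 1 z) (s≤s (s≤s z≤n)))) (suc N))

-- Arbitrary codimension and the resulting sequence

adjoin-variables : ∀ {k e} (X : OrderIdeal k) → IsPure X e → ∀ n →
  Σ (OrderIdeal (n + k)) λ Y → IsPure Y e × countDeg Y 0 ≡ countDeg X 0 ×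
    (∀ i → i < e → countDeg Y (suc i) ≡ n + countDeg X (suc i))
adjoin-variables X pure zero = X , pure , refl , λ _ _ → refl
adjoin-variables {e = e} X pure (suc n) with Y , pureY , count-0 , count-suc ← adjoin-variables X pure n =
  ideal , ideal-pure ,
  trans (countDeg-ideal 0 z≤n) (trans (+-identityʳ _) count-0) ,
  λ i i<e → trans (countDeg-ideal (suc i) i<e)
    (trans (+-comm (countDeg Y (suc i)) 1) (cong suc (count-suc i i<e)))
  where open AddVariable Y e pureY

theorem3p9 : (M r : ℕ) → 2 ≤ M → 3 ≤ r →
    Σ ℕ λ e → Σ (Vec ℕ (suc e)) λ h →
    IsPureOSeq h × h ! 1 ≡ r × ¬ Unimodal h × HasExactlyMaxima M h
theorem3p9 (suc K) r (s≤s 1≤K) 3≤r =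
  e , h , (n + 3 , Y , pureY , λ i i≤e → prefix-! (countDeg Y) (s≤s i≤e)) ,
  trans (h-suc 0 (≤-trans (s≤s z≤n) (m≤n+m a N))) (trans (cong (n +_) H-1) (m∸n+n≡m 3≤r)) ,
  not-unimodal 1≤K , exactly-maxima
  where
  -- Each of the `K` valleys takes three steps of the final stretch from `a` to `e`.
  N = K * 3
  open Construction N
  n = r ∸ 3

  extended = adjoin-variables ideal ideal-pure n
  Y        = proj₁ extended
  pureY    = proj₁ (proj₂ extended)

  h : Vec ℕ (suc e)
  h = prefix (countDeg Y) (suc e)

  h-suc : ∀ i → i < e → h ! suc i ≡ n + H (suc i)
  h-suc i i<e = trans (prefix-! (countDeg Y) (s≤s i<e))
    (trans (proj₂ (proj₂ (proj₂ extended)) i i<e) (cong (n +_) (countDeg-ideal (suc i) i<e)))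

  -- In degree 0 the new variables add nothing, so only an inequality holds there. It bounds the
  -- smaller side in `rise`, where an upper bound is what counts.
  h-≤ : ∀ i → i ≤ e → h ! i ≤ n + H i
  h-≤ (suc i) i<e = ≤-reflexive (h-suc i i<e)
  h-≤ zero    _   = ≤-trans
    (≤-reflexive (trans (proj₁ (proj₂ (proj₂ extended))) (countDeg-ideal 0 z≤n)))
    (m≤n+m (H 0) n)

  h-≡ : ∀ i → a ≤ i → i ≤ e → h ! i ≡ n + H i
  h-≡ zero    ()
  h-≡ (suc i) _ i<e = h-suc i i<e

  rise : ∀ i → i < a → h ! i < h ! suc i
  rise i i<a = ≤-<-trans (h-≤ i (<⇒≤ i<e))
    (<-≤-trans (+-monoʳ-< n (H-rise i i<a)) (≤-reflexive (sym (h-suc i i<e))))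
    where
    i<e : i < e
    i<e = ≤-trans i<a (m≤n+m a N)

  zigzag : ∀ k → k < K →
     h ! (1 + (k * 3 + a)) < h ! (k * 3 + a) ×
     h ! (2 + (k * 3 + a)) ≡ h ! (1 + (k * 3 + a)) ×
     h ! (2 + (k * 3 + a)) < h ! (3 + (k * 3 + a))
  zigzag k k<K = let down , flat , up = H-valley j l l< j+≡e in
    subst₂ _<_ (sym h1) (sym h0) (+-monoʳ-< n (≤-reflexive down)) ,
    trans h2 (trans (cong (n +_) flat) (sym h1)) ,
    subst₂ _<_ (sym h2) (sym h3) (+-monoʳ-< n (≤-reflexive (sym up)))
    where
    j = k * 3 + a
    -- Valleys are indexed by `k` from below, while `width` depends on the distance to `e`; `l`
    -- counts the valleys above the `k`-th.
    l = K ∸ suc k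

    l< : 3 + l * 3 ≤ N
    l< = *-monoˡ-≤ 3 (∸-monoʳ-< {o = 0} (s≤s z≤n) k<K)

    j+≡e : 3 + (l * 3 + j) ≡ e
    j+≡e = begin
      3 + (l * 3 + (k * 3 + a))   ≡⟨ regroup l k a ⟩
      (suc k + l) * 3 + a         ≡⟨ cong (λ t → t * 3 + a) (m+[n∸m]≡n k<K) ⟩
      K * 3 + a                   ∎
      where
      open ≡-Reasoning
      regroup : ∀ l k a → 3 + (l * 3 + (k * 3 + a)) ≡ (suc k + l) * 3 + a
      regroup = solve-∀

    3+j≤e : 3 + j ≤ e
    3+j≤e = ≤-trans (+-monoʳ-≤ 3 (m≤n+m j (l * 3))) (≤-reflexive j+≡e)

    h0 = h-≡ j (m≤n+m a (k * 3)) (≤-trans (m≤n+m j 3) 3+j≤e)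
    h1 = h-suc j (≤-trans (m≤n+m (1 + j) 2) 3+j≤e)
    h2 = h-suc (1 + j) (≤-trans (m≤n+m (2 + j) 1) 3+j≤e)
    h3 = h-suc (2 + j) 3+j≤e

  open Zigzag a K h rise zigzag
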